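{- Let $\mathfrak{X}=(\Omega,S)$ be a scheme, and let $b\in S^\cup$ be a connected relation with $b=b^*$. For any nonempty subset $T$ of $\Omega$ we have \[ \frac{|\partial_b(T)|}{|T|}\geq\frac{2(1-|T|/|\Omega|)}{\mathrm{diam}(b)+|T|/|\Omega|}. \] In particular, if $|T|\leq|\Omega|/2$, then \[ \frac{|\partial_b(T)|}{|T|}\geq\frac{2}{2\,\mathrm{diam}(b)+1}. \]
   Context: Let $\Omega$ be a finite set. For a relation $a\subseteq\Omega\times\Omega$ write $a^*=\{(\beta,\alpha)\mid(\alpha,\beta)\in a\}$, and let $1_\Omega=\{(\alpha,\alpha)\mid\alpha\in\Omega\}$. A scheme (homogeneous coherent configuration) is a pair $\mathfrak{X}=(\Omega,S)$ where $S$ is a partition of $\Omega\times\Omega$ into relations such that: (1) $1_\Omega\in S$; (2) if $a\in S$ then $a^*\in S$; (3) for any $a,b,c\in S$ the number $|\{\gamma\in\Omega\mid(\alpha,\gamma)\in b,\ (\gamma,\beta)\in c\}|$ does not depend on the choice of $(\alpha,\beta)\in a$. $S^\cup$ denotes the set of all unions of relations from $S$. Relations are viewed as graphs on the vertex set $\Omega$; a relation $b$ with $b=b^*$ is an undirected graph (loops allowed), connected means connected as a graph, and $\mathrm{diam}(b)$ is the maximum distance in $b$ between two vertices. For $T\subseteq\Omega$, $\partial_b(T)=\{\beta\in\Omega\setminus T\mid(\alpha,\beta)\in b\text{ for some }\alpha\in T\}$. -}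

module Defs where

open import Data.Bool using (Bool; true)
import Data.Bool.Properties as Bool
open import Data.Fin using (Fin)
open import Data.Fin.Properties using (any?; nonZeroIndex) renaming (_≟_ to _≟ᶠ_)
open import Data.Fin.Subset using (Subset; _∈_; ∣_∣; Nonempty)
open import Data.Fin.Subset.Properties using (_∈?_; x∈p⇒∣p-x∣<∣p∣)
open import Data.Integer using (+_)
open import Data.List using (allFin; cartesianProduct; map)
open import Data.List.Extrema.Nat using (max)
open import Data.Nat using (ℕ; zero; suc; _<_; s<s; >-nonZero)
import Data.Nat as ℕ
import Data.Nat.Properties as ℕ
open import Data.Product using (Σ; ∃-syntax; _×_; _,_; proj₁; uncurry)
open import Data.Rational using (ℚ; _/_; _+_; NonZero)
open import Data.Rational.Properties
  using (normalize-pos; normalize-nonNeg; nonNeg+pos⇒pos; pos⇒nonZero)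
open import Data.Vec using (tabulate)
open import Function using (flip; _∘_; _⇔_)
open import Level using (0ℓ)
open import Relation.Binary.PropositionalEquality using (_≡_)
open import Relation.Nullary using (Dec; yes; no; ¬_; does; ¬?; _×-dec_)
open import Relation.Unary using (Pred; Decidable)

private variable
  n : ℕ

comprehension : {P : Pred (Fin n) 0ℓ} → Decidable P → Subset n
comprehension P? = tabulate (does ∘ P?)

-- The finite set Ω is Fin n.  A relation a ⊆ Ω × Ω is given by its
-- characteristic function.

Relation : ℕ → Set
Relation n = Fin n → Fin n → Bool

infix 4 _∈ʳ_ _∈ʳ?_ _≐_ _∈∪_

_∈ʳ_ : Fin n × Fin n → Relation n → Set
(α , β) ∈ʳ a = a α β ≡ true

_∈ʳ?_ : (p : Fin n × Fin n) (a : Relation n) → Dec (p ∈ʳ a)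
(α , β) ∈ʳ? a = a α β Bool.≟ true

-- Equality of relations as sets of pairs.
_≐_ : Relation n → Relation n → Set
a ≐ b = ∀ α β → a α β ≡ b α β

_* : Relation n → Relation n
a * = flip a

1Ω : Relation n
1Ω α β = does (α ≟ᶠ β)

between : Relation n → Relation n → Fin n → Fin n → Subset n
between b c α β = comprehension λ γ → ((α , γ) ∈ʳ? b) ×-dec ((γ , β) ∈ʳ? c)

-- The partition S is listed without repetition as rel i, i : Fin rank.
record Scheme (n : ℕ) : Set where
  field
    rank     : ℕ
    rel      : Fin rank → Relation n
    nonempty : ∀ i → ∃[ p ] p ∈ʳ rel i
    disjoint : ∀ {i j p} → p ∈ʳ rel i → p ∈ʳ rel j → i ≡ j
    cover    : ∀ p → ∃[ i ] p ∈ʳ rel i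
    identity : ∃[ i ] rel i ≐ 1Ω
    converse : ∀ i → ∃[ j ] rel j ≐ rel i *
    regular  : ∀ a b c {α β α′ β′} →
               (α , β) ∈ʳ rel a → (α′ , β′) ∈ʳ rel a →
               ∣ between (rel b) (rel c) α β ∣ ≡ ∣ between (rel b) (rel c) α′ β′ ∣

-- b ∈∪ 𝔛 is b ∈ S^∪; the set I of classes may be empty.
_∈∪_ : Relation n → Scheme n → Set
b ∈∪ 𝔛 = Σ (Subset rank) λ I → ∀ p → p ∈ʳ b ⇔ (∃[ i ] (i ∈ I × p ∈ʳ rel i))
  where open Scheme 𝔛

-- Walk b k α β: there is a walk with k steps from α to β in the graph b.
Walk : Relation n → ℕ → Fin n → Fin n → Set
Walk b zero    α β = α ≡ β
Walk b (suc k) α β = ∃[ γ ] ((α , γ) ∈ʳ b × Walk b k γ β)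

walk? : (b : Relation n) (k : ℕ) (α β : Fin n) → Dec (Walk b k α β)
walk? b zero    α β = α ≟ᶠ β
walk? b (suc k) α β = any? λ γ → ((α , γ) ∈ʳ? b) ×-dec walk? b k γ β

Connected : Relation n → Set
Connected b = ∀ α β → ∃[ k ] Walk b k α β

least : {P : Pred ℕ 0ℓ} → Decidable P → ∀ m → P m →
        ∃[ k ] (P k × (∀ j → j < k → ¬ P j))
least P? zero p = zero , p , λ _ ()
least {P} P? (suc m) p with P? zero
... | yes p₀ = zero , p₀ , λ _ ()
... | no ¬p₀ with least (P? ∘ suc) m p
...   | k , pk , min = suc k , pk , min′
  where
  min′ : ∀ j → j < suc k → ¬ P j
  min′ zero    _         = ¬p₀
  min′ (suc j) (s<s j<k) = min j j<k

dist : (b : Relation n) → Connected b → Fin n → Fin n → ℕ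
dist b conn α β = proj₁ (uncurry (least λ k → walk? b k α β) (conn α β))

diam : (b : Relation n) → Connected b → ℕ
diam {n} b conn =
  max 0 (map (uncurry (dist b conn)) (cartesianProduct (allFin n) (allFin n)))

∂ : Relation n → Subset n → Subset n
∂ b T = comprehension λ β →
  ¬? (β ∈? T) ×-dec any? λ α → (α ∈? T) ×-dec ((α , β) ∈ʳ? b)

-- The denominators in the inequality do not vanish.

∣T∣≢0 : {T : Subset n} → Nonempty T → ℕ.NonZero ∣ T ∣
∣T∣≢0 (_ , x∈T) = >-nonZero (ℕ.m<n⇒0<n (x∈p⇒∣p-x∣<∣p∣ x∈T))

∣Ω∣≢0 : {T : Subset n} → Nonempty T → ℕ.NonZero n
∣Ω∣≢0 (x , _) = nonZeroIndex x

d+m/k≢0 : ∀ d m k .{{_ : ℕ.NonZero m}} .{{_ : ℕ.NonZero k}} →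
          NonZero (+ d / 1 + + m / k)
d+m/k≢0 d m k = pos⇒nonZero (p + q)
  {{nonNeg+pos⇒pos p {{normalize-nonNeg d 1}} q {{normalize-pos m k}}}}
  where
  p q : ℚ
  p = + d / 1
  q = + m / k

{-# OPTIONS --safe #-}

-- For each class a of 𝔛 fix a length k ≤ diam b of b-walks joining the pairs in a.
-- By regularity, the number N > 0 of such walks is the same for all pairs in a, and
-- the walks with k steps joining pairs in a are, at each time, equidistributed over Ω.
-- Averaged over all pairs (α , β) and all walks chosen for them, the number of visits to
-- ∂ T at the times 0, …, k − 1 is therefore at most diam b · |∂ T| / |Ω|.  On the
-- other hand, a walk with exactly one endpoint in T visits ∂ T before time k,
-- except possibly when α ∈ T and β ∈ ∂ T.  Counting pairs gives
-- 2 |T| (|Ω| − |T|) ≤ |∂ T| (diam b · |Ω| + |T|).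

module Submission where

open import Defs
open import Data.Fin.Subset using (Subset; ∣_∣; Nonempty)
open import Data.Nat using (ℕ; suc)
open import Data.Product using (_×_; _,_)
import Data.Integer as ℤ
import Data.Integer.Properties as ℤ
import Data.Integer.Tactic.RingSolver as ℤ-Solver
import Data.Nat as ℕ
import Data.Rational as ℚ
import Data.Rational.Properties as ℚ
import Data.Rational.Unnormalised as ℚᵘ
import Data.Rational.Unnormalised.Properties as ℚᵘ
open import Relation.Binary.PropositionalEquality
  using (_≡_; _≢_; refl; sym; trans; cong; cong₂; subst₂; module ≡-Reasoning)

module Counting where

  open import Data.Bool using (Bool; true; false; not; _∧_; _xor_)
  import Data.Bool.Properties as Bool
  open import Data.Fin using (Fin; zero; suc)
  import Data.Fin.Properties as Fin
  open import Data.Fin.Subset.Properties using (_∈?_)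
  open import Data.List.Extrema.Nat using (v≤max⁺)
  open import Data.List.Membership.Propositional.Properties
    using (∈-map⁺; ∈-cartesianProduct⁺; ∈-allFin)
  import Data.List.Relation.Unary.Any as Any
  open import Data.Nat
    using (zero; _+_; _*_; _≤_; _<_; z≤n; s≤s; NonZero; >-nonZero)
  open import Data.Nat.Properties
  open import Data.Nat.Tactic.RingSolver using (solve-∀)
  open import Data.Product using (proj₁; proj₂; ∃-syntax; uncurry)
  open import Data.Sum using (inj₂)
  open import Data.Vec using ([]; _∷_; lookup)
  open import Data.Vec.Properties using (lookup∘tabulate; []=⇒lookup; lookup⇒[]=)
  open import Function using (_∘_; Equivalence; mk⇔)
  open import Relation.Nullary using (yes; no; does; contradiction; ¬?; _×-dec_)
  open import Relation.Nullary.Decidable using (dec-true)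
  open import Algebra.Properties.Semiring.Sum +-*-semiring
    using (sum; sum-cong-≗; ∑-comm; ∑-distrib-+; *-distribˡ-sum; *-distribʳ-sum)

  private variable
    m n : ℕ

  -- Finite sums of natural numbers.

  sum-mono-≤ : {f g : Fin n → ℕ} → (∀ i → f i ≤ g i) → sum f ≤ sum g
  sum-mono-≤ {zero}  f≤g = z≤n
  sum-mono-≤ {suc n} f≤g = +-mono-≤ (f≤g zero) (sum-mono-≤ (f≤g ∘ suc))

  term≤sum : (f : Fin n → ℕ) → ∀ i → f i ≤ sum f
  term≤sum f zero    = m≤m+n _ _
  term≤sum f (suc i) = ≤-trans (term≤sum (f ∘ suc) i) (m≤n+m _ _)

  sum-const : ∀ n c → sum {n} (λ _ → c) ≡ n * c
  sum-const zero    c = refl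
  sum-const (suc n) c = cong (c +_) (sum-const n c)

  sum-zero : {f : Fin n → ℕ} → (∀ i → f i ≡ 0) → sum f ≡ 0
  sum-zero {n} f≡0 = trans (sum-cong-≗ f≡0) (trans (sum-const n 0) (*-zeroʳ n))

  sum-single : (f : Fin n → ℕ) → ∀ i → (∀ j → j ≢ i → f j ≡ 0) → sum f ≡ f i
  sum-single f zero    f≡0 =
    trans (cong (f zero +_) (sum-zero λ j → f≡0 (suc j) λ ())) (+-identityʳ _)
  sum-single f (suc i) f≡0 =
    cong₂ _+_ (f≡0 zero λ ())
      (sum-single (f ∘ suc) i λ j j≢i → f≡0 (suc j) (j≢i ∘ Fin.suc-injective))

  sum-*-sum : (f : Fin m → ℕ) (g : Fin n → ℕ) →
              sum f * sum g ≡ sum λ i → sum λ j → f i * g j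
  sum-*-sum f g = trans (*-distribʳ-sum (sum g) f) (sum-cong-≗ λ i → *-distribˡ-sum (f i) g)

  -- Writing the `n` copies as a sum over `j` allows `r i` to be replaced by `r j`, and the double
  -- sum then splits. Applied to vertices, it says that equal visiting rates turn the weight of a
  -- set into its size over `n`.
  sum-*-const : (f r : Fin n → ℕ) → (∀ i j → r i ≡ r j) →
                n * sum (λ i → f i * r i) ≡ sum f * sum r
  sum-*-const {n} f r const = begin
    n * sum (λ i → f i * r i)              ≡⟨ sum-const n _ ⟨
    (sum λ (j : Fin n) → sum λ i → f i * r i)
      ≡⟨ sum-cong-≗ (λ j → sum-cong-≗ λ i → cong (f i *_) (const i j)) ⟩
    (sum λ j → sum λ i → f i * r j)        ≡⟨ ∑-comm (λ j i → f i * r j) ⟩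
    (sum λ i → sum λ j → f i * r j)        ≡⟨ sum-*-sum f r ⟨
    sum f * sum r                          ∎
    where open ≡-Reasoning

  -- Indicators and cardinalities.

  χ : Bool → ℕ
  χ true  = 1
  χ false = 0

  χ-∧ : ∀ x y → χ (x ∧ y) ≡ χ x * χ y
  χ-∧ true  y = sym (+-identityʳ _)
  χ-∧ false y = refl

  χ-xor : ∀ x y → χ (x xor y) ≡ χ x * χ (not y) + χ (not x) * χ y
  χ-xor true  true  = refl
  χ-xor true  false = refl
  χ-xor false true  = refl
  χ-xor false false = refl

  ∣p∣≡sum : (p : Subset n) → ∣ p ∣ ≡ sum (χ ∘ lookup p)
  ∣p∣≡sum []          = refl
  ∣p∣≡sum (true  ∷ p) = cong suc (∣p∣≡sum p)
  ∣p∣≡sum (false ∷ p) = ∣p∣≡sum p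

  sum-χ-not : (f : Fin n → Bool) → sum (χ ∘ f) + sum (χ ∘ not ∘ f) ≡ n
  sum-χ-not {n} f = begin
    sum (χ ∘ f) + sum (χ ∘ not ∘ f)    ≡⟨ ∑-distrib-+ (χ ∘ f) (χ ∘ not ∘ f) ⟨
    sum (λ i → χ (f i) + χ (not (f i))) ≡⟨ sum-cong-≗ (λ i → χ-not (f i)) ⟩
    sum {n} (λ _ → 1)                  ≡⟨ sum-const n 1 ⟩
    n * 1                              ≡⟨ *-identityʳ n ⟩
    n                                  ∎
    where
    open ≡-Reasoning
    χ-not : ∀ x → χ x + χ (not x) ≡ 1
    χ-not true  = refl
    χ-not false = refl

  -- Matrices indexed by vertices and their inner product.

  Matrix : ℕ → Set
  Matrix n = Fin n → Fin n → ℕ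

  infixl 7 _∙_

  _∙_ : Matrix n → Matrix n → Matrix n
  (M ∙ N) α β = sum λ γ → M α γ * N γ β

  _ᵗ : Matrix n → Matrix n
  (M ᵗ) α β = M β α

  -- The entrywise inner product, that is, the trace of `M ᵗ ∙ N`. If `M` is the indicator of a
  -- class, it sums `N` over that class.
  ⟪_,_⟫ : Matrix n → Matrix n → ℕ
  ⟪ M , N ⟫ = sum λ α → sum λ β → M α β * N α β

  χʳ : Relation n → Matrix n
  χʳ a α β = χ (a α β)

  -- Moves the first step of a walk from the counting matrix into the weight `M`, which drives the
  -- induction in `visits-average`.
  ⟪,⟫-adjoint : (M A N : Matrix n) → ⟪ M , A ∙ N ⟫ ≡ ⟪ A ᵗ ∙ M , N ⟫
  ⟪,⟫-adjoint M A N = begin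
    (sum λ α → sum λ β → M α β * sum λ δ → A α δ * N δ β)
      ≡⟨ sum-cong-≗ (λ α → sum-cong-≗ λ β → *-distribˡ-sum (M α β) λ δ → A α δ * N δ β) ⟩
    (sum λ α → sum λ β → sum λ δ → M α β * (A α δ * N δ β))
      ≡⟨ sum-cong-≗ (λ α → ∑-comm λ β δ → M α β * (A α δ * N δ β)) ⟩
    (sum λ α → sum λ δ → sum λ β → M α β * (A α δ * N δ β))
      ≡⟨ ∑-comm (λ α δ → sum λ β → M α β * (A α δ * N δ β)) ⟩
    (sum λ δ → sum λ α → sum λ β → M α β * (A α δ * N δ β))
      ≡⟨ sum-cong-≗ (λ δ → ∑-comm λ α β → M α β * (A α δ * N δ β)) ⟩
    (sum λ δ → sum λ β → sum λ α → M α β * (A α δ * N δ β))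
      ≡⟨ sum-cong-≗ (λ δ → sum-cong-≗ λ β → sum-cong-≗ λ α →
           rearrange (M α β) (A α δ) (N δ β)) ⟩
    (sum λ δ → sum λ β → sum λ α → A α δ * M α β * N δ β)
      ≡⟨ sum-cong-≗ (λ δ → sum-cong-≗ λ β →
           sym (*-distribʳ-sum (N δ β) λ α → A α δ * M α β)) ⟩
    (sum λ δ → sum λ β → (sum λ α → A α δ * M α β) * N δ β) ∎
    where
    open ≡-Reasoning
    rearrange : ∀ x y z → x * (y * z) ≡ y * x * z
    rearrange = solve-∀

  ⟪,⟫-congʳ : (M : Matrix n) {N P : Matrix n} → (∀ α β → M α β * N α β ≡ M α β * P α β) →
              ⟪ M , N ⟫ ≡ ⟪ M , P ⟫
  ⟪,⟫-congʳ M eq = sum-cong-≗ λ α → sum-cong-≗ λ β → eq α β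

  ⟪,⟫-monoʳ-≤ : (M : Matrix n) {N P : Matrix n} → (∀ α β → N α β ≤ P α β) →
                ⟪ M , N ⟫ ≤ ⟪ M , P ⟫
  ⟪,⟫-monoʳ-≤ M N≤P = sum-mono-≤ λ α → sum-mono-≤ λ β → *-monoʳ-≤ (M α β) (N≤P α β)

  ⟪,⟫-distribˡ-+ : (M N P : Matrix n) →
                   ⟪ M , (λ α β → N α β + P α β) ⟫ ≡ ⟪ M , N ⟫ + ⟪ M , P ⟫
  ⟪,⟫-distribˡ-+ M N P = trans
    (sum-cong-≗ λ α → trans
      (sum-cong-≗ λ β → *-distribˡ-+ (M α β) (N α β) (P α β))
      (∑-distrib-+ (λ β → M α β * N α β) (λ β → M α β * P α β)))
    (∑-distrib-+ (λ α → sum λ β → M α β * N α β) (λ α → sum λ β → M α β * P α β))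

  ⟪,⟫-scaleʳ : ∀ c (M N : Matrix n) → ⟪ M , (λ α β → c * N α β) ⟫ ≡ c * ⟪ M , N ⟫
  ⟪,⟫-scaleʳ c M N = begin
    (sum λ α → sum λ β → M α β * (c * N α β))
      ≡⟨ sum-cong-≗ (λ α → sum-cong-≗ λ β → rearrange c (M α β) (N α β)) ⟩
    (sum λ α → sum λ β → c * (M α β * N α β))
      ≡⟨ sum-cong-≗ (λ α → sym (*-distribˡ-sum c λ β → M α β * N α β)) ⟩
    (sum λ α → c * sum λ β → M α β * N α β)
      ≡⟨ *-distribˡ-sum c (λ α → sum λ β → M α β * N α β) ⟨
    c * ⟪ M , N ⟫ ∎
    where
    open ≡-Reasoning
    rearrange : ∀ x y z → y * (x * z) ≡ x * (y * z)
    rearrange = solve-∀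

  -- Powers of a matrix, which count walks, and visits of walks to a set.

  walks : Matrix n → ℕ → Matrix n
  walks A zero    = χʳ 1Ω
  walks A (suc k) = A ∙ walks A k

  -- Over all walks with k steps from α to β, counts the visits to D at the times
  -- 0, …, k − 1; the endpoint at time k is left out.
  visits : Matrix n → (Fin n → ℕ) → ℕ → Matrix n
  visits A D zero    α β = 0
  visits A D (suc k) α β = D α * walks A (suc k) α β + (A ∙ visits A D k) α β

  -- The first step of the given walk singles out a positive term of the sum. Positivity lets
  -- `class-bound` cancel the number of walks.
  walk⇒walks>0 : (b : Relation n) → ∀ k {α β} → Walk b k α β → 0 < walks (χʳ b) k α β
  walk⇒walks>0 b zero {α} refl rewrite dec-true (α Fin.≟ α) refl = s≤s z≤n
  walk⇒walks>0 b (suc k) {α} {β} (γ , αγ , w) = ≤-trans pos (term≤sum _ γ)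
    where
    pos : 0 < χ (b α γ) * walks (χʳ b) k γ β
    pos rewrite αγ = ≤-trans (walk⇒walks>0 b k w) (m≤m+n _ 0)

  -- Walks with exactly one endpoint in `T`.

  module _ (b : Relation n) (D : Fin n → Bool) where

    private
      W = walks (χʳ b)
      H = visits (χʳ b) (χ ∘ D)

    -- A visit at time 0 is counted by `H` unless `k` is 0, and then the start is also the end.
    walks-from-D : ∀ k α β → χ (D α) * W k α β ≤ H k α β + χ (D β) * W k α β
    walks-from-D zero α β with α Fin.≟ β
    ... | yes refl = ≤-refl
    ... | no _     = ≤-reflexive (trans (*-zeroʳ (χ (D α))) (sym (*-zeroʳ (χ (D β)))))
    walks-from-D (suc k) α β = ≤-trans (m≤m+n _ _) (m≤m+n _ _)

    module _ (T : Fin n → Bool)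
      -- Modelled on `D = ∂ T`: on an edge between `T` and its complement, the vertex outside `T`
      -- lies in `D`, whichever way the edge is traversed.
      (enter : ∀ {α δ} → b α δ ≡ true → T α ≡ false → T δ ≡ true → D α ≡ true)
      (leave : ∀ {α δ} → b α δ ≡ true → T α ≡ true → T δ ≡ false → D δ ≡ true)
      where

      private
        -- Case analysis on the first edge of a walk. `t`, `t′`, `q` tell whether the first, second
        -- and last vertex lie in `T`, and `e`, `e′`, `e″` whether they lie in `D`; `w` walks
        -- continue from the second vertex, with `h` counted visits in total.
        step : ∀ {w h} t t′ q e e′ e″ →
          (t ≡ false → t′ ≡ true → e ≡ true) → (t ≡ true → t′ ≡ false → e′ ≡ true) →
          χ e′ * w ≤ h + χ e″ * w →
          w * χ (t′ xor q) ≤ h + w * χ (t′ ∧ e″) →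
          w * χ (t xor q) ≤ χ e * w + h + w * χ (t ∧ e″)
        step {w} false _ false _ _ _ _ _ _ _ rewrite *-zeroʳ w = z≤n
        step {w} true  _ true  _ _ _ _ _ _ _ rewrite *-zeroʳ w = z≤n
        -- The edge enters `T`, so its start lies in `D` and all `w` walks visit `D` at time 0.
        step {w} {h} false true  true e _ _ en _ _ _ rewrite en refl refl | *-identityʳ w
          | +-identityʳ w = ≤-trans (m≤m+n w h) (m≤m+n _ _)
        step {w} {h} false false true e _ _ _ _ _ ih =
          ≤-trans ih (+-monoˡ-≤ (w * 0) (m≤n+m h (χ e * w)))
        -- The exceptional pairs, with start in `T` and end in `D`: the last term alone accounts for
        -- all `w` walks.
        step true _ false _ _ true _ _ _ _ = m≤n+m _ _
        step {w} {h} true true  false e _ false _ _ _ ih =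
          ≤-trans ih (+-monoˡ-≤ (w * 0) (m≤n+m h (χ e * w)))
        -- The edge leaves `T`, so the second vertex lies in `D`. Its visit is among those counted
        -- by `h`, since the last vertex is not in `D`.
        step {w} {h} true false false e _ false _ le l _ rewrite le refl refl
          | *-identityʳ w | *-zeroʳ w | +-identityʳ w | +-identityʳ h
          | +-identityʳ (χ e * w + h) = ≤-trans l (m≤n+m h (χ e * w))

      -- A walk with exactly one endpoint in T visits D; the visit may be the last
      -- vertex, which H does not count, only if the walk goes from T to D.
      walks-across : ∀ k α β →
        W k α β * χ (T α xor T β) ≤ H k α β + W k α β * χ (T α ∧ D β)
      walks-across zero α β with α Fin.≟ β
      ... | yes refl rewrite Bool.xor-same (T α) = z≤n
      ... | no _     = z≤n
      walks-across (suc k) α β = begin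
        (sum λ δ → A δ * W k δ β) * χ (T α xor T β)
          ≡⟨ *-distribʳ-sum (χ (T α xor T β)) (λ δ → A δ * W k δ β) ⟩
        (sum λ δ → A δ * W k δ β * χ (T α xor T β))
          ≤⟨ sum-mono-≤ each ⟩
        (sum λ δ → χ (D α) * (A δ * W k δ β) + A δ * H k δ β + A δ * W k δ β * s)
          ≡⟨ ∑-distrib-+ (λ δ → χ (D α) * (A δ * W k δ β) + A δ * H k δ β)
               (λ δ → A δ * W k δ β * s) ⟩
        (sum λ δ → χ (D α) * (A δ * W k δ β) + A δ * H k δ β)
          + (sum λ δ → A δ * W k δ β * s)
          ≡⟨ cong₂ _+_
               (trans (∑-distrib-+ (λ δ → χ (D α) * (A δ * W k δ β)) (λ δ → A δ * H k δ β))
                 (cong (_+ (χʳ b ∙ H k) α β)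
                   (sym (*-distribˡ-sum (χ (D α)) λ δ → A δ * W k δ β))))
               (sym (*-distribʳ-sum s λ δ → A δ * W k δ β)) ⟩
        H (suc k) α β + W (suc k) α β * s ∎
        where
        open ≤-Reasoning
        A = λ δ → χ (b α δ)
        s = χ (T α ∧ D β)
        each : ∀ δ → A δ * W k δ β * χ (T α xor T β) ≤
                     χ (D α) * (A δ * W k δ β) + A δ * H k δ β + A δ * W k δ β * s
        each δ with b α δ in αδ
        ... | false = z≤n
        ... | true rewrite +-identityʳ (W k δ β) | +-identityʳ (H k δ β) =
          step (T α) (T δ) (T β) (D α) (D δ) (D β) (enter αδ) (leave αδ)
            (walks-from-D k δ β) (walks-across k δ β)

  -- The adjacency algebra of a scheme.

  does-≟true : ∀ x → does (x Bool.≟ true) ≡ x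
  does-≟true true  = refl
  does-≟true false = refl

  ∣between∣≡sum : (b c : Relation n) → ∀ α β → ∣ between b c α β ∣ ≡ (χʳ b ∙ χʳ c) α β
  ∣between∣≡sum b c α β = trans (∣p∣≡sum (between b c α β)) (sum-cong-≗ λ γ → begin
    χ (lookup (between b c α β) γ)                            ≡⟨ cong χ (lookup∘tabulate _ γ) ⟩
    χ (does (b α γ Bool.≟ true) ∧ does (c γ β Bool.≟ true))   ≡⟨ χ-∧ (does (b α γ Bool.≟ true)) _ ⟩
    χ (does (b α γ Bool.≟ true)) * χ (does (c γ β Bool.≟ true))
      ≡⟨ cong₂ (λ x y → χ x * χ y) (does-≟true (b α γ)) (does-≟true (c γ β)) ⟩
    χ (b α γ) * χ (c γ β)                                     ∎)
    where open ≡-Reasoning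

  module _ (𝔛 : Scheme n) where

    open Scheme 𝔛

    -- The matrices of the adjacency algebra of 𝔛.
    Invariant : Matrix n → Set
    Invariant M = ∀ {i α β α′ β′} → (α , β) ∈ʳ rel i → (α′ , β′) ∈ʳ rel i → M α β ≡ M α′ β′

    χ-rel-≢ : ∀ {i j α β} → (α , β) ∈ʳ rel i → j ≢ i → χʳ (rel j) α β ≡ 0
    χ-rel-≢ {i} {j} {α} {β} αβ∈i j≢i with rel j α β in eq
    ... | true  = contradiction (disjoint eq αβ∈i) j≢i
    ... | false = refl

    sum-rel : ∀ {i α β} (F : Fin rank → ℕ) → (α , β) ∈ʳ rel i →
              sum (λ j → χʳ (rel j) α β * F j) ≡ F i
    sum-rel {i} {α} {β} F αβ∈i = begin
      sum (λ j → χʳ (rel j) α β * F j)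
        ≡⟨ sum-single _ i (λ j j≢i → cong (λ x → x * F j) (χ-rel-≢ αβ∈i j≢i)) ⟩
      χʳ (rel i) α β * F i  ≡⟨ cong (λ x → χ x * F i) αβ∈i ⟩
      1 * F i               ≡⟨ *-identityˡ (F i) ⟩
      F i                   ∎
      where open ≡-Reasoning

    -- Read off at a representative pair; for invariant `M` these are the coefficients of `M` in the
    -- basis of class indicators.
    value : Matrix n → Fin rank → ℕ
    value M i = uncurry M (proj₁ (nonempty i))

    invariant-expand : {M : Matrix n} → Invariant M → ∀ α β →
                       M α β ≡ sum λ i → χʳ (rel i) α β * value M i
    invariant-expand {M} inv α β with cover (α , β)
    ... | i , αβ∈i = trans (inv αβ∈i (proj₂ (nonempty i))) (sym (sum-rel (value M) αβ∈i))

    -- Each pair lies in exactly one class, so `sum-rel` collapses the sum over classes.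
    sum-classes : (X : Matrix n) → sum (λ i → ⟪ χʳ (rel i) , X ⟫) ≡ sum λ α → sum λ β → X α β
    sum-classes X = begin
      (sum λ i → sum λ α → sum λ β → χʳ (rel i) α β * X α β)
        ≡⟨ ∑-comm (λ i α → sum λ β → χʳ (rel i) α β * X α β) ⟩
      (sum λ α → sum λ i → sum λ β → χʳ (rel i) α β * X α β)
        ≡⟨ sum-cong-≗ (λ α → ∑-comm λ i β → χʳ (rel i) α β * X α β) ⟩
      (sum λ α → sum λ β → sum λ i → χʳ (rel i) α β * X α β)
        ≡⟨ sum-cong-≗ (λ α → sum-cong-≗ λ β →
             sum-rel (λ _ → X α β) (proj₂ (cover (α , β)))) ⟩
      (sum λ α → sum λ β → X α β) ∎
      where open ≡-Reasoning

    -- Bilinearity reduces the product to products of class indicators, whose entries are the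
    -- intersection numbers.
    ∙-expand : {M N : Matrix n} → Invariant M → Invariant N → ∀ α β →
               (M ∙ N) α β ≡ sum λ i → sum λ j →
                 value M i * value N j * ∣ between (rel i) (rel j) α β ∣
    ∙-expand {M} {N} invM invN α β = begin
      (sum λ γ → M α γ * N γ β)
        ≡⟨ sum-cong-≗ (λ γ → trans
             (cong₂ _*_ (invariant-expand invM α γ) (invariant-expand invN γ β))
             (sum-*-sum (λ i → R i α γ * value M i) (λ j → R j γ β * value N j))) ⟩
      (sum λ γ → sum λ i → sum λ j → R i α γ * value M i * (R j γ β * value N j))
        ≡⟨ ∑-comm (λ γ i → sum λ j → R i α γ * value M i * (R j γ β * value N j)) ⟩
      (sum λ i → sum λ γ → sum λ j → R i α γ * value M i * (R j γ β * value N j))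
        ≡⟨ sum-cong-≗ (λ i → ∑-comm λ γ j → R i α γ * value M i * (R j γ β * value N j)) ⟩
      (sum λ i → sum λ j → sum λ γ → R i α γ * value M i * (R j γ β * value N j))
        ≡⟨ sum-cong-≗ (λ i → sum-cong-≗ λ j → coefficient i j) ⟩
      (sum λ i → sum λ j → value M i * value N j * ∣ between (rel i) (rel j) α β ∣) ∎
      where
      open ≡-Reasoning
      R = χʳ ∘ rel
      rearrange : ∀ x y z w → x * y * (z * w) ≡ y * w * (x * z)
      rearrange = solve-∀
      coefficient : ∀ i j → sum (λ γ → R i α γ * value M i * (R j γ β * value N j)) ≡
                    value M i * value N j * ∣ between (rel i) (rel j) α β ∣
      coefficient i j = begin
        sum (λ γ → R i α γ * value M i * (R j γ β * value N j))
          ≡⟨ sum-cong-≗ (λ γ → rearrange (R i α γ) (value M i) (R j γ β) (value N j)) ⟩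
        sum (λ γ → value M i * value N j * (R i α γ * R j γ β))
          ≡⟨ *-distribˡ-sum (value M i * value N j) (λ γ → R i α γ * R j γ β) ⟨
        value M i * value N j * (R i ∙ R j) α β
          ≡⟨ cong (value M i * value N j *_) (∣between∣≡sum (rel i) (rel j) α β) ⟨
        value M i * value N j * ∣ between (rel i) (rel j) α β ∣ ∎

    -- In the expansion only the intersection numbers depend on the pair, and by `regular` they are
    -- constant on classes.
    ∙-invariant : {M N : Matrix n} → Invariant M → Invariant N → Invariant (M ∙ N)
    ∙-invariant {M} {N} invM invN {a} {α} {β} {α′} {β′} αβ∈a α′β′∈a = begin
      (M ∙ N) α β    ≡⟨ ∙-expand {M} {N} invM invN α β ⟩
      _              ≡⟨ sum-cong-≗ (λ i → sum-cong-≗ λ j →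
                          cong (value M i * value N j *_) (regular a i j αβ∈a α′β′∈a)) ⟩
      _              ≡⟨ ∙-expand {M} {N} invM invN α′ β′ ⟨
      (M ∙ N) α′ β′  ∎
      where open ≡-Reasoning

    ᵗ-invariant : {M : Matrix n} → Invariant M → Invariant (M ᵗ)
    ᵗ-invariant inv {i} {α} {β} {α′} {β′} αβ∈i α′β′∈i with converse i
    ... | j , j≐i* = inv (trans (j≐i* β α) αβ∈i) (trans (j≐i* β′ α′) α′β′∈i)

    rel-invariant : ∀ i → Invariant (χʳ (rel i))
    rel-invariant i {j} {α} {β} {α′} {β′} αβ∈j α′β′∈j with i Fin.≟ j
    ... | yes refl = cong χ (trans αβ∈j (sym α′β′∈j))
    ... | no  i≢j  = trans (χ-rel-≢ αβ∈j i≢j) (sym (χ-rel-≢ α′β′∈j i≢j))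

    1Ω-invariant : Invariant (χʳ 1Ω)
    1Ω-invariant {i} {α} {β} {α′} {β′} p q with identity
    ... | j , j≐1 = trans (cong χ (sym (j≐1 α β)))
                      (trans (rel-invariant j p q) (cong χ (j≐1 α′ β′)))

    -- By disjointness, a class in `I` containing one of the two pairs must be their common class,
    -- hence contains the other pair too.
    union-invariant : {b : Relation n} → b ∈∪ 𝔛 → Invariant (χʳ b)
    union-invariant {b} (I , b⇔) p q =
      cong χ (Bool.⇔→≡ (mk⇔ (λ r → transport r p q) (λ r → transport r q p)))
      where
      transport : ∀ {i p q} → p ∈ʳ b → p ∈ʳ rel i → q ∈ʳ rel i → q ∈ʳ b
      transport {i} r p q with Equivalence.to (b⇔ _) r
      ... | j , j∈I , s with disjoint s p
      ...   | refl = Equivalence.from (b⇔ _) (i , j∈I , q)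

    -- By `identity`, the diagonal pairs form a single class.
    invariant-diagonal : {M : Matrix n} → Invariant M → ∀ α β → M α α ≡ M β β
    invariant-diagonal inv α β with identity
    ... | i , i≐1 = inv (diagonal α) (diagonal β)
      where
      diagonal : ∀ γ → (γ , γ) ∈ʳ rel i
      diagonal γ = trans (i≐1 γ γ) (dec-true (γ Fin.≟ γ) refl)

    -- Equidistribution of walks over the vertices.

    module _ {A : Matrix n} (invA : Invariant A) where

      walks-invariant : ∀ k → Invariant (walks A k)
      walks-invariant zero    = 1Ω-invariant
      walks-invariant (suc k) = ∙-invariant {A} {walks A k} invA (walks-invariant k)

      -- Every vertex is visited equally often at each given time, because the diagonal
      -- of an invariant matrix is constant.
      visits-average : (D : Fin n → ℕ) → ∀ k {M} → Invariant M →
        n * ⟪ M , visits A D k ⟫ ≡ k * sum D * ⟪ M , walks A k ⟫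
      visits-average D zero {M} invM = begin
        n * ⟪ M , (λ _ _ → 0) ⟫
          ≡⟨ cong (n *_) (sum-zero λ α → sum-zero λ β → *-zeroʳ (M α β)) ⟩
        n * 0  ≡⟨ *-zeroʳ n ⟩
        0      ∎
        where open ≡-Reasoning
      visits-average D (suc k) {M} invM = begin
        n * ⟪ M , visits A D (suc k) ⟫
          ≡⟨ cong (n *_) (⟪,⟫-distribˡ-+ M (λ α β → D α * W α β) (A ∙ visits A D k)) ⟩
        n * (⟪ M , (λ α β → D α * W α β) ⟫ + ⟪ M , A ∙ visits A D k ⟫)
          ≡⟨ *-distribˡ-+ n ⟪ M , (λ α β → D α * W α β) ⟫ _ ⟩
        n * ⟪ M , (λ α β → D α * W α β) ⟫ + n * ⟪ M , A ∙ visits A D k ⟫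
          ≡⟨ cong₂ _+_ first rest ⟩
        sum D * ⟪ M , W ⟫ + k * sum D * ⟪ M , W ⟫
          ≡⟨ *-distribʳ-+ ⟪ M , W ⟫ (sum D) (k * sum D) ⟨
        suc k * sum D * ⟪ M , W ⟫ ∎
        where
        open ≡-Reasoning
        W = walks A (suc k)
        rearrange : ∀ x y z → x * (y * z) ≡ y * (x * z)
        rearrange = solve-∀
        first : n * ⟪ M , (λ α β → D α * W α β) ⟫ ≡ sum D * ⟪ M , W ⟫
        first = begin
          n * ⟪ M , (λ α β → D α * W α β) ⟫
            ≡⟨ cong (n *_) (sum-cong-≗ λ α → trans
                 (sum-cong-≗ λ β → rearrange (M α β) (D α) (W α β))
                 (sym (*-distribˡ-sum (D α) λ β → M α β * W α β))) ⟩
          -- The weighted number of walks starting at `α` is a diagonal entry of the invariant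
          -- matrix `M ∙ W ᵗ`, hence the same for every `α`.
          n * sum (λ α → D α * (M ∙ W ᵗ) α α)
            ≡⟨ sum-*-const D (λ α → (M ∙ W ᵗ) α α)
                 (invariant-diagonal {M ∙ W ᵗ}
                   (∙-invariant {M} {W ᵗ} invM (ᵗ-invariant {W} (walks-invariant (suc k))))) ⟩
          sum D * ⟪ M , W ⟫ ∎
        rest : n * ⟪ M , A ∙ visits A D k ⟫ ≡ k * sum D * ⟪ M , W ⟫
        rest = begin
          n * ⟪ M , A ∙ visits A D k ⟫
            -- Dropping the first step replaces the weight `M` by `A ᵗ ∙ M`, which is again
            -- invariant; the induction therefore ranges over all invariant weights.
            ≡⟨ cong (n *_) (⟪,⟫-adjoint M A (visits A D k)) ⟩
          n * ⟪ A ᵗ ∙ M , visits A D k ⟫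
            ≡⟨ visits-average D k (∙-invariant {A ᵗ} {M} (ᵗ-invariant {A} invA) invM) ⟩
          k * sum D * ⟪ A ᵗ ∙ M , walks A k ⟫
            ≡⟨ cong (k * sum D *_) (⟪,⟫-adjoint M A (walks A k)) ⟨
          k * sum D * ⟪ M , W ⟫ ∎

    -- Double counting of the pairs separated by `T`.

    module _ {b : Relation n} (b∈∪ : b ∈∪ 𝔛) (D : Fin n → Bool) (T : Fin n → Bool)
      (enter : ∀ {α δ} → b α δ ≡ true → T α ≡ false → T δ ≡ true → D α ≡ true)
      (leave : ∀ {α δ} → b α δ ≡ true → T α ≡ true → T δ ≡ false → D δ ≡ true)
      where

      private
        across into one : Matrix n
        across α β = χ (T α xor T β)
        into α β = χ (T α ∧ D β)
        one α β = 1

      -- A walk for one pair suffices: by invariance every pair of the class has the same number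
      -- `N > 0` of walks with `k` steps. Summing `walks-across` over the class and averaging the
      -- visits gives the bound multiplied by `N`, which cancels.
      class-bound : ∀ i {k d α₀ β₀} → (α₀ , β₀) ∈ʳ rel i → Walk b k α₀ β₀ → k ≤ d →
        n * ⟪ χʳ (rel i) , across ⟫ ≤
        d * sum (χ ∘ D) * ⟪ χʳ (rel i) , one ⟫ + n * ⟪ χʳ (rel i) , into ⟫
      class-bound i {k} {d} {α₀} {β₀} αβ∈i walk k≤d = *-cancelˡ-≤ N (begin
        N * (n * ⟪ R , across ⟫)
          ≡⟨ swap N n ⟪ R , across ⟫ ⟩
        n * (N * ⟪ R , across ⟫)
          ≡⟨ cong (n *_) (N-out across) ⟩
        n * ⟪ R , (λ α β → W α β * across α β) ⟫
          ≤⟨ *-monoʳ-≤ n (⟪,⟫-monoʳ-≤ R (walks-across b D T enter leave k)) ⟩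
        n * ⟪ R , (λ α β → H α β + W α β * into α β) ⟫
          ≡⟨ cong (n *_) (⟪,⟫-distribˡ-+ R H (λ α β → W α β * into α β)) ⟩
        n * (⟪ R , H ⟫ + ⟪ R , (λ α β → W α β * into α β) ⟫)
          ≡⟨ cong (λ x → n * (⟪ R , H ⟫ + x)) (N-out into) ⟨
        n * (⟪ R , H ⟫ + N * ⟪ R , into ⟫)
          ≡⟨ *-distribˡ-+ n ⟪ R , H ⟫ (N * ⟪ R , into ⟫) ⟩
        n * ⟪ R , H ⟫ + n * (N * ⟪ R , into ⟫)
          ≡⟨ cong (_+ n * (N * ⟪ R , into ⟫))
               (visits-average (union-invariant b∈∪) (χ ∘ D) k (rel-invariant i)) ⟩
        k * ∣D∣ * ⟪ R , W ⟫ + n * (N * ⟪ R , into ⟫)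
          ≡⟨ cong (λ x → k * ∣D∣ * x + n * (N * ⟪ R , into ⟫)) R-W ⟩
        k * ∣D∣ * (N * ⟪ R , one ⟫) + n * (N * ⟪ R , into ⟫)
          ≤⟨ +-monoˡ-≤ (n * (N * ⟪ R , into ⟫))
               (*-monoˡ-≤ (N * ⟪ R , one ⟫) (*-monoˡ-≤ ∣D∣ k≤d)) ⟩
        d * ∣D∣ * (N * ⟪ R , one ⟫) + n * (N * ⟪ R , into ⟫)
          ≡⟨ factor (d * ∣D∣) N ⟪ R , one ⟫ n ⟪ R , into ⟫ ⟩
        N * (d * ∣D∣ * ⟪ R , one ⟫ + n * ⟪ R , into ⟫) ∎)
        where
        open ≤-Reasoning
        R = χʳ (rel i)
        W = walks (χʳ b) k
        H = visits (χʳ b) (χ ∘ D) k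
        ∣D∣ = sum (χ ∘ D)
        N = W α₀ β₀
        instance
          N≢0 : NonZero N
          N≢0 = >-nonZero (walk⇒walks>0 b k walk)
        swap : ∀ x y z → x * (y * z) ≡ y * (x * z)
        swap = solve-∀
        factor : ∀ x N y n z → x * (N * y) + n * (N * z) ≡ N * (x * y + n * z)
        factor = solve-∀
        -- The factor `R α β` restricts the claim to pairs of class `i`, on which `W` has the
        -- constant value `N`.
        N≡W : ∀ α β X → R α β * (N * X) ≡ R α β * (W α β * X)
        N≡W α β X with rel i α β in eq
        ... | true  = cong (λ w → 1 * (w * X))
                        (walks-invariant (union-invariant b∈∪) k αβ∈i eq)
        ... | false = refl
        N-out : ∀ X → N * ⟪ R , X ⟫ ≡ ⟪ R , (λ α β → W α β * X α β) ⟫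
        N-out X = trans (sym (⟪,⟫-scaleʳ N R X)) (⟪,⟫-congʳ R λ α β → N≡W α β (X α β))
        R-W : ⟪ R , W ⟫ ≡ N * ⟪ R , one ⟫
        R-W = trans (⟪,⟫-congʳ R λ α β → cong (R α β *_) (sym (*-identityʳ (W α β))))
                    (sym (N-out one))

      -- The walk length may vary with the class: `class-bound` retains only its upper bound `d`, so
      -- the classes can be summed.
      pair-bound : ∀ {d} → (∀ α β → ∃[ k ] (k ≤ d × Walk b k α β)) →
        n * (sum λ α → sum λ β → across α β) ≤
        d * sum (χ ∘ D) * (n * n) + n * (sum λ α → sum λ β → into α β)
      pair-bound {d} short = begin
        n * (sum λ α → sum λ β → across α β)
          ≡⟨ cong (n *_) (sum-classes across) ⟨
        n * (sum λ i → ⟪ R i , across ⟫)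
          ≡⟨ *-distribˡ-sum n (λ i → ⟪ R i , across ⟫) ⟩
        (sum λ i → n * ⟪ R i , across ⟫)
          ≤⟨ sum-mono-≤ (λ i → let (_ , αβ∈i) = nonempty i
                                   (_ , k≤d , walk) = short _ _
                               in class-bound i αβ∈i walk k≤d) ⟩
        (sum λ i → d * ∣D∣ * ⟪ R i , one ⟫ + n * ⟪ R i , into ⟫)
          ≡⟨ ∑-distrib-+ (λ i → d * ∣D∣ * ⟪ R i , one ⟫) (λ i → n * ⟪ R i , into ⟫) ⟩
        (sum λ i → d * ∣D∣ * ⟪ R i , one ⟫) + (sum λ i → n * ⟪ R i , into ⟫)
          ≡⟨ cong₂ _+_ (*-distribˡ-sum (d * ∣D∣) (λ i → ⟪ R i , one ⟫))
                       (*-distribˡ-sum n (λ i → ⟪ R i , into ⟫)) ⟨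
        d * ∣D∣ * (sum λ i → ⟪ R i , one ⟫) + n * (sum λ i → ⟪ R i , into ⟫)
          ≡⟨ cong₂ (λ x y → d * ∣D∣ * x + n * y)
               (trans (sum-classes one) count) (sum-classes into) ⟩
        d * ∣D∣ * (n * n) + n * (sum λ α → sum λ β → into α β) ∎
        where
        open ≤-Reasoning
        R = χʳ ∘ rel
        ∣D∣ = sum (χ ∘ D)
        count : (sum λ α → sum λ β → one α β) ≡ n * n
        count = trans (sum-const n (sum {n} λ _ → 1))
                      (cong (n *_) (trans (sum-const n 1) (*-identityʳ n)))

      -- Ordered pairs separated by `T` are counted by the left side, once for each direction, and
      -- pairs in `into` form the product of `T` and `D`. A common factor `n` cancels from
      -- `pair-bound`.
      expansion : .{{_ : NonZero n}} → ∀ {d} → (∀ α β → ∃[ k ] (k ≤ d × Walk b k α β)) →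
        2 * (sum (χ ∘ T) * sum (χ ∘ not ∘ T)) ≤ sum (χ ∘ D) * (d * n + sum (χ ∘ T))
      expansion {d} short = *-cancelˡ-≤ n (begin
        n * (2 * (∣T∣ * ∣T̅∣))
          ≡⟨ cong (n *_) (double ∣T∣ ∣T̅∣) ⟩
        n * (∣T∣ * ∣T̅∣ + ∣T̅∣ * ∣T∣)
          ≡⟨ cong (n *_) (cong₂ _+_ (sum-*-sum (χ ∘ T) (χ ∘ not ∘ T))
                                    (sum-*-sum (χ ∘ not ∘ T) (χ ∘ T))) ⟩
        n * ((sum λ α → sum λ β → χ (T α) * χ (not (T β)))
           + (sum λ α → sum λ β → χ (not (T α)) * χ (T β)))
          ≡⟨ cong (n *_) (∑-distrib-+ (λ α → sum λ β → χ (T α) * χ (not (T β)))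
                                      (λ α → sum λ β → χ (not (T α)) * χ (T β))) ⟨
        n * (sum λ α → (sum λ β → χ (T α) * χ (not (T β)))
                     + (sum λ β → χ (not (T α)) * χ (T β)))
          ≡⟨ cong (n *_) (sum-cong-≗ λ α →
               trans (sum-cong-≗ λ β → χ-xor (T α) (T β))
                 (∑-distrib-+ (λ β → χ (T α) * χ (not (T β)))
                              (λ β → χ (not (T α)) * χ (T β)))) ⟨
        n * (sum λ α → sum λ β → across α β)
          ≤⟨ pair-bound short ⟩
        d * ∣D∣ * (n * n) + n * (sum λ α → sum λ β → into α β)
          ≡⟨ cong (λ x → d * ∣D∣ * (n * n) + n * x)
               (trans (sum-cong-≗ λ α → sum-cong-≗ λ β → χ-∧ (T α) (D β))
                      (sym (sum-*-sum (χ ∘ T) (χ ∘ D)))) ⟩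
        d * ∣D∣ * (n * n) + n * (∣T∣ * ∣D∣)
          ≡⟨ factor d ∣D∣ n ∣T∣ ⟩
        n * (∣D∣ * (d * n + ∣T∣)) ∎)
        where
        open ≤-Reasoning
        ∣T∣ = sum (χ ∘ T)
        ∣T̅∣ = sum (χ ∘ not ∘ T)
        ∣D∣ = sum (χ ∘ D)
        double : ∀ x y → 2 * (x * y) ≡ x * y + y * x
        double = solve-∀
        factor : ∀ d x n t → d * x * (n * n) + n * (t * x) ≡ n * (x * (d * n + t))
        factor = solve-∀

  -- Diameter, boundary and the inequality in natural numbers.

  module _ (b : Relation n) (conn : Connected b) where

    walk-dist : ∀ α β → Walk b (dist b conn α β) α β
    walk-dist α β =
      proj₁ (proj₂ (uncurry (least λ k → walk? b k α β) (conn α β)))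

    dist≤diam : ∀ α β → dist b conn α β ≤ diam b conn
    dist≤diam α β = v≤max⁺ 0 _ (inj₂ (Any.map ≤-reflexive
      (∈-map⁺ (uncurry (dist b conn)) (∈-cartesianProduct⁺ (∈-allFin α) (∈-allFin β)))))

  ∈-∂ : (b : Relation n) {T : Subset n} {α β : Fin n} → lookup T α ≡ true →
        lookup T β ≡ false → (α , β) ∈ʳ b → lookup (∂ b T) β ≡ true
  ∈-∂ b {T} {α} {β} α∈T β∉T αβ∈b = trans (lookup∘tabulate _ β) (dec-true
    (¬? (β ∈? T) ×-dec Fin.any? λ α → (α ∈? T) ×-dec ((α , β) ∈ʳ? b))
    ( (λ β∈T → contradiction (trans (sym β∉T) ([]=⇒lookup β∈T)) λ ())
    , α , lookup⇒[]= α T α∈T , αβ∈b ))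

  -- The witness `c` is the size of the complement of `T`; introducing it through a sum avoids
  -- truncated subtraction.
  ∂-expansion : (𝔛 : Scheme n) {b : Relation n} → b ∈∪ 𝔛 → (conn : Connected b) → b ≐ b * →
    .{{_ : NonZero n}} → (T : Subset n) →
    ∃[ c ] (∣ T ∣ + c ≡ n × 2 * (∣ T ∣ * c) ≤ ∣ ∂ b T ∣ * (diam b conn * n + ∣ T ∣))
  ∂-expansion 𝔛 {b} b∈∪ conn sym-b T rewrite ∣p∣≡sum T | ∣p∣≡sum (∂ b T) =
      sum (χ ∘ not ∘ lookup T)
    , sum-χ-not (lookup T)
    , expansion 𝔛 b∈∪ (lookup (∂ b T)) (lookup T)
        -- `∂` is defined by edges going out of `T`, so an edge entering `T` is first reversed by
        -- symmetry of `b`.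
        (λ αδ α∉T δ∈T → ∈-∂ b δ∈T α∉T (trans (sym (sym-b _ _)) αδ))
        (λ αδ α∈T δ∉T → ∈-∂ b α∈T δ∉T αδ)
        λ α β → dist b conn α β , dist≤diam b conn α β , walk-dist b conn α β

  -- At most half of the vertices lie in `T`, so `n ≤ 2 * c`; this removes `c` from the left of the
  -- bound, and `t * 2 ≤ n * 1` removes `t` from the right. A common factor `n` then cancels.
  expansion-small : ∀ p d t c n .{{_ : NonZero n}} → t + c ≡ n →
    2 * (t * c) ≤ p * (d * n + t) → t * 2 ≤ n * 1 → 2 * t ≤ p * (1 + 2 * d)
  expansion-small p d t c n t+c≡n bound 2t≤n = *-cancelˡ-≤ n (begin
    n * (2 * t)                ≤⟨ *-monoˡ-≤ (2 * t) n≤2c ⟩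
    2 * c * (2 * t)            ≡⟨ regroup c t ⟩
    2 * (2 * (t * c))          ≤⟨ *-monoʳ-≤ 2 bound ⟩
    2 * (p * (d * n + t))      ≡⟨ expand p d n t ⟩
    p * (2 * d * n + t * 2)    ≤⟨ *-monoʳ-≤ p (+-monoʳ-≤ (2 * d * n) 2t≤n) ⟩
    p * (2 * d * n + n * 1)    ≡⟨ factor p d n ⟩
    n * (p * (1 + 2 * d))      ∎)
    where
    open ≤-Reasoning
    regroup : ∀ x y → 2 * x * (2 * y) ≡ 2 * (2 * (y * x))
    regroup = solve-∀
    expand : ∀ p d n t → 2 * (p * (d * n + t)) ≡ p * (2 * d * n + t * 2)
    expand = solve-∀
    factor : ∀ p d n → p * (2 * d * n + n * 1) ≡ n * (p * (1 + 2 * d))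
    factor = solve-∀
    t≤c : t ≤ c
    t≤c = +-cancelˡ-≤ t t c (begin
      t + t      ≡⟨ cong (t +_) (+-identityʳ t) ⟨
      2 * t      ≡⟨ *-comm 2 t ⟩
      t * 2      ≤⟨ 2t≤n ⟩
      n * 1      ≡⟨ *-identityʳ n ⟩
      n          ≡⟨ t+c≡n ⟨
      t + c      ∎)
    n≤2c : n ≤ 2 * c
    n≤2c = begin
      n          ≡⟨ t+c≡n ⟨
      t + c      ≤⟨ +-monoˡ-≤ c t≤c ⟩
      c + c      ≡⟨ cong (c +_) (+-identityʳ c) ⟨
      2 * c      ∎

-- Transfer to rational numbers.

open import Data.Integer using (+_)
open Counting using (∂-expansion; expansion-small)
open import Data.Rational using (_/_; _+_; _-_; _*_; _÷_; _≤_; _≥_; 1ℚ)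

-- Unnormalised fractions keep `a` and `b` as numerator and denominator, so inequalities between
-- them are plain cross-multiplications.
toℚᵘ-/ : ∀ a b .{{_ : ℕ.NonZero b}} → ℚ.toℚᵘ (a / b) ℚᵘ.≃ a ℚᵘ./ b
toℚᵘ-/ a (suc b) = ℚ.toℚᵘ-fromℚᵘ (ℚᵘ.mkℚᵘ a b)

/-mono-≤ : ∀ a b c d .{{_ : ℕ.NonZero b}} .{{_ : ℕ.NonZero d}} →
           a ℕ.* d ℕ.≤ c ℕ.* b → + a / b ≤ + c / d
/-mono-≤ a b@(suc _) c d@(suc _) ad≤cb = ℚ.toℚᵘ-cancel-≤ (begin
  ℚ.toℚᵘ (+ a / b)  ≃⟨ toℚᵘ-/ (+ a) b ⟩
  + a ℚᵘ./ b        ≤⟨ ℚᵘ.*≤* (subst₂ ℤ._≤_ (ℤ.pos-* a d) (ℤ.pos-* c b) (ℤ.+≤+ ad≤cb)) ⟩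
  + c ℚᵘ./ d        ≃⟨ toℚᵘ-/ (+ c) d ⟨
  ℚ.toℚᵘ (+ c / d)  ∎)
  where open ℚᵘ.≤-Reasoning

/-cancel-≤ : ∀ a b c d .{{_ : ℕ.NonZero b}} .{{_ : ℕ.NonZero d}} →
             + a / b ≤ + c / d → a ℕ.* d ℕ.≤ c ℕ.* b
/-cancel-≤ a b@(suc _) c d@(suc _) a/b≤c/d =
  ℤ.drop‿+≤+ (subst₂ ℤ._≤_ (sym (ℤ.pos-* a d)) (sym (ℤ.pos-* c b)) (ℚᵘ.drop-*≤* (begin
    + a ℚᵘ./ b        ≃⟨ toℚᵘ-/ (+ a) b ⟨
    ℚ.toℚᵘ (+ a / b)  ≤⟨ ℚ.toℚᵘ-mono-≤ a/b≤c/d ⟩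
    ℚ.toℚᵘ (+ c / d)  ≃⟨ toℚᵘ-/ (+ c) d ⟩
    + c ℚᵘ./ d        ∎)))
  where open ℚᵘ.≤-Reasoning

p≤q*r⇒p÷r≤q : ∀ p q r .{{_ : ℚ.NonZero r}} .{{_ : ℚ.Positive r}} →
               p ≤ q * r → p ÷ r ≤ q
p≤q*r⇒p÷r≤q p q r p≤qr = ℚ.*-cancelʳ-≤-pos r (begin
  p * ℚ.1/ r * r    ≡⟨ ℚ.*-assoc p (ℚ.1/ r) r ⟩
  p * (ℚ.1/ r * r)  ≡⟨ cong (p *_) (ℚ.*-inverseˡ r) ⟩
  p * 1ℚ            ≡⟨ ℚ.*-identityʳ p ⟩
  p                 ≤⟨ p≤qr ⟩
  q * r             ∎)
  where open ℚ.≤-Reasoning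

-- After cross-multiplication, and with `c` in place of `n - t`, this is the natural-number bound
-- multiplied by `n`.
twice-complement-ratio-≤ : ∀ p d t c n .{{_ : ℕ.NonZero t}} .{{_ : ℕ.NonZero n}} → t ℕ.+ c ≡ n →
  2 ℕ.* (t ℕ.* c) ℕ.≤ p ℕ.* (d ℕ.* n ℕ.+ t) →
  + 2 / 1 * (1ℚ - + t / n) ≤ + p / t * (+ d / 1 + + t / n)
twice-complement-ratio-≤ p d t@(suc _) c n@(suc _) t+c≡n bound = ℚ.toℚᵘ-cancel-≤ (begin
  ℚ.toℚᵘ (+ 2 / 1 * (1ℚ - + t / n))
    ≃⟨ ℚ.toℚᵘ-homo-* (+ 2 / 1) (1ℚ - + t / n) ⟩
  ℚ.toℚᵘ (+ 2 / 1) ℚᵘ.* ℚ.toℚᵘ (1ℚ - + t / n)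
    ≃⟨ ℚᵘ.*-cong (toℚᵘ-/ (+ 2) 1) (ℚᵘ.≃-trans (ℚ.toℚᵘ-homo-+ 1ℚ (ℚ.- (+ t / n)))
         (ℚᵘ.+-cong {ℚᵘ.1ℚᵘ} ℚᵘ.≃-refl
           (ℚᵘ.≃-trans (ℚ.toℚᵘ-homo‿- (+ t / n)) (ℚᵘ.-‿cong (toℚᵘ-/ (+ t) n))))) ⟩
  + 2 ℚᵘ./ 1 ℚᵘ.* (ℚᵘ.1ℚᵘ ℚᵘ.- + t ℚᵘ./ n)
    ≤⟨ ℚᵘ.*≤* cross-multiplied ⟩
  + p ℚᵘ./ t ℚᵘ.* (+ d ℚᵘ./ 1 ℚᵘ.+ + t ℚᵘ./ n)
    ≃⟨ ℚᵘ.*-cong (toℚᵘ-/ (+ p) t) (ℚᵘ.≃-trans (ℚ.toℚᵘ-homo-+ (+ d / 1) (+ t / n))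
         (ℚᵘ.+-cong (toℚᵘ-/ (+ d) 1) (toℚᵘ-/ (+ t) n))) ⟨
  ℚ.toℚᵘ (+ p / t) ℚᵘ.* ℚ.toℚᵘ (+ d / 1 + + t / n)
    ≃⟨ ℚ.toℚᵘ-homo-* (+ p / t) (+ d / 1 + + t / n) ⟨
  ℚ.toℚᵘ (+ p / t * (+ d / 1 + + t / n)) ∎)
  where
  open ℚᵘ.≤-Reasoning
  -- The factors `+ 1` come from the denominators of integers written as fractions. Substituting
  -- `t + c` for `n` leaves a ring identity.
  lhs : ∀ t c n → t ℤ.+ c ≡ n →
    + 2 ℤ.* (t ℤ.* c) ℤ.* n ≡
    + 2 ℤ.* (+ 1 ℤ.* n ℤ.+ ℤ.- t ℤ.* + 1) ℤ.* (t ℤ.* (+ 1 ℤ.* n))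
  lhs t c _ refl = identity t c
    where
    identity : ∀ t c →
      + 2 ℤ.* (t ℤ.* c) ℤ.* (t ℤ.+ c) ≡
      + 2 ℤ.* (+ 1 ℤ.* (t ℤ.+ c) ℤ.+ ℤ.- t ℤ.* + 1) ℤ.* (t ℤ.* (+ 1 ℤ.* (t ℤ.+ c)))
    identity = ℤ-Solver.solve-∀
  rhs : ∀ p d t n →
    p ℤ.* (d ℤ.* n ℤ.+ t) ℤ.* n ≡
    p ℤ.* (d ℤ.* n ℤ.+ t ℤ.* + 1) ℤ.* (+ 1 ℤ.* (+ 1 ℤ.* n))
  rhs = ℤ-Solver.solve-∀
  bound′ : + 2 ℤ.* (+ t ℤ.* + c) ℤ.≤ + p ℤ.* (+ d ℤ.* + n ℤ.+ + t)
  bound′ = subst₂ ℤ._≤_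
    (trans (ℤ.pos-* 2 (t ℕ.* c)) (cong (+ 2 ℤ.*_) (ℤ.pos-* t c)))
    (trans (ℤ.pos-* p (d ℕ.* n ℕ.+ t)) (cong (λ x → + p ℤ.* (x ℤ.+ + t)) (ℤ.pos-* d n)))
    (ℤ.+≤+ bound)
  cross-multiplied :
    + 2 ℤ.* (+ 1 ℤ.* + n ℤ.+ ℤ.- + t ℤ.* + 1) ℤ.* (+ t ℤ.* (+ 1 ℤ.* + n)) ℤ.≤
    + p ℤ.* (+ d ℤ.* + n ℤ.+ + t ℤ.* + 1) ℤ.* (+ 1 ℤ.* (+ 1 ℤ.* + n))
  cross-multiplied = subst₂ ℤ._≤_
    (lhs (+ t) (+ c) (+ n) (cong +_ t+c≡n))
    (rhs (+ p) (+ d) (+ t) (+ n))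
    (ℤ.*-monoʳ-≤-nonNeg (+ n) bound′)

ratio-bounds : ∀ p d t c n .{{_ : ℕ.NonZero t}} .{{_ : ℕ.NonZero n}} → t ℕ.+ c ≡ n →
  2 ℕ.* (t ℕ.* c) ℕ.≤ p ℕ.* (d ℕ.* n ℕ.+ t) →
  let instance nzD = d+m/k≢0 d t n in
  (+ p / t ≥ (+ 2 / 1 * (1ℚ - + t / n)) ÷ (+ d / 1 + + t / n))
  × (+ t / 1 ≤ + n / 2 → + p / t ≥ + 2 / (1 ℕ.+ 2 ℕ.* d))
ratio-bounds p d t c n t+c≡n bound =
    p≤q*r⇒p÷r≤q (+ 2 / 1 * (1ℚ - + t / n)) (+ p / t) (+ d / 1 + + t / n)
      {{d+m/k≢0 d t n}}
      {{ℚ.nonNeg+pos⇒pos (+ d / 1) {{ℚ.normalize-nonNeg d 1}} (+ t / n) {{ℚ.normalize-pos t n}}}}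
      (twice-complement-ratio-≤ p d t c n t+c≡n bound)
  , λ t≤n/2 → /-mono-≤ 2 (1 ℕ.+ 2 ℕ.* d) p t
      (expansion-small p d t c n t+c≡n bound (/-cancel-≤ t 1 n 2 t≤n/2))

proposition2p2 :
    ∀ {n : ℕ} (𝔛 : Scheme n) (b : Relation n) →
    b ∈∪ 𝔛 → (conn : Connected b) → b ≐ b * →
    (T : Subset n) (ne : Nonempty T) →
    let d = diam b conn
        instance nzT = ∣T∣≢0 ne
        instance nzΩ = ∣Ω∣≢0 ne
        instance nzD = d+m/k≢0 d ∣ T ∣ n
    in
    (+ ∣ ∂ b T ∣ / ∣ T ∣ ≥ (+ 2 / 1 * (1ℚ - + ∣ T ∣ / n)) ÷ (+ d / 1 + + ∣ T ∣ / n))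
    × (+ ∣ T ∣ / 1 ≤ + n / 2 →
       + ∣ ∂ b T ∣ / ∣ T ∣ ≥ + 2 / (1 ℕ.+ 2 ℕ.* d))
proposition2p2 {n} 𝔛 b b∈∪ conn b≐b* T ne =
  let instance nzT = ∣T∣≢0 ne
               nzΩ = ∣Ω∣≢0 ne
      c , t+c≡n , bound = ∂-expansion 𝔛 b∈∪ conn b≐b* T
  in ratio-bounds (∣ ∂ b T ∣) (diam b conn) (∣ T ∣) c n t+c≡n bound
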